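{- Let $k\ge 2$ be an integer and let $G$ be a $\{C_3,C_5,C_{2k},C_{2k+2}\}$-free graph with maximum degree $\Delta$. Then $\omega_2'(G)\le \max\{k\Delta,\,2k(k-1)\}$.
   Context: Graphs are finite and simple. $C_m$ denotes the cycle with $m$ vertices; a graph is $\mathcal F$-free, for a set $\mathcal F$ of graphs, if it contains no member of $\mathcal F$ as a (not necessarily induced) subgraph. A strong clique of $G$ is a set of edges of $G$ such that any two distinct edges in the set either share an endpoint or are connected by an edge of $G$ (i.e. some edge of $G$ joins an endpoint of one to an endpoint of the other). The strong clique number $\omega_2'(G)$ is the size of a largest strong clique of $G$. -}

module Defs where

open import Data.Fin using (Fin; toℕ; _<_; _<?_)
open import Data.Fin.Properties using (_≟_; any?)
open import Data.List using (List; []; _∷_; _++_; map; filter; length; allFin; cartesianProduct)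
open import Data.List.Extrema.Nat using (max)
open import Data.List.Relation.Unary.All using (All; all?)
open import Data.Nat as ℕ using (ℕ; suc)
open import Data.Product using (_×_; _,_; ∃; ∃₂; proj₁; proj₂)
open import Data.Product.Properties using (≡-dec)
open import Data.Sum using (_⊎_; swap)
open import Function using (_∘_)
open import Function.Definitions using (Injective)
open import Level using (0ℓ)
open import Relation.Binary using (Rel; Symmetric; Decidable; DecidableEquality)
open import Relation.Binary.PropositionalEquality using (_≡_; _≢_; refl; sym)
open import Relation.Nullary using (¬_; Dec; ¬?)
open import Relation.Nullary.Decidable using (_×-dec_; _⊎-dec_; _→-dec_)
import Relation.Unary as U

record Graph : Set₁ where
  infix 4 _~_ _~?_
  field
    order    : ℕ
    _~_      : Rel (Fin order) 0ℓ
    _~?_     : Decidable _~_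
    ~-sym    : Symmetric _~_
    ~-irrefl : ∀ {v} → ¬ (v ~ v)

  Vertex : Set
  Vertex = Fin order

open Graph using (order; Vertex)

infix 4 _⊑_

-- Not necessarily induced subgraph containment.
_⊑_ : Graph → Graph → Set
F ⊑ G = ∃ λ (f : Vertex F → Vertex G) →
  Injective _≡_ _≡_ f × (∀ {u v} → Graph._~_ F u v → Graph._~_ G (f u) (f v))

_-Free_ : List Graph → Graph → Set₁
𝓕 -Free G = All (λ F → ¬ (F ⊑ G)) 𝓕

module _ (m : ℕ) where

  -- j is the cyclic successor of i in 0, 1, …, m - 1.
  Next : Rel (Fin m) 0ℓ
  Next i j = (toℕ j ≡ suc (toℕ i)) ⊎ (suc (toℕ i) ≡ m × toℕ j ≡ 0)

  next? : Decidable Next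
  next? i j =
    (toℕ j ℕ.≟ suc (toℕ i)) ⊎-dec ((suc (toℕ i) ℕ.≟ m) ×-dec (toℕ j ℕ.≟ 0))

  -- The cycle with m vertices, for m ≥ 3.  The condition i ≢ j only
  -- matters for m = 1, where it removes a loop.
  C : Graph
  C = record
    { order    = m
    ; _~_      = λ i j → i ≢ j × (Next i j ⊎ Next j i)
    ; _~?_     = λ i j → ¬? (i ≟ j) ×-dec (next? i j ⊎-dec next? j i)
    ; ~-sym    = λ (i≢j , s) → i≢j ∘ sym , swap s
    ; ~-irrefl = λ (v≢v , _) → v≢v refl
    }

sublists : ∀ {A : Set} → List A → List (List A)
sublists []       = [] ∷ []
sublists (x ∷ xs) = map (x ∷_) (sublists xs) ++ sublists xs

module _ (G : Graph) where
  open Graph G using (_~_; _~?_)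

  degree : Vertex G → ℕ
  degree v = length (filter (v ~?_) (allFin (order G)))

  -- Equal to 0 for the graph without vertices.
  maxDegree : ℕ
  maxDegree = max 0 (map degree (allFin (order G)))

  Pair : Set
  Pair = Vertex G × Vertex G

  _≟ₚ_ : DecidableEquality Pair
  _≟ₚ_ = ≡-dec _≟_ _≟_

  -- The edge {u , v} is represented once, by the ordered pair with u < v.
  IsEdge : Pair → Set
  IsEdge (u , v) = u < v × u ~ v

  isEdge? : U.Decidable IsEdge
  isEdge? (u , v) = (u <? v) ×-dec (u ~? v)

  edges : List Pair
  edges = filter isEdge? (cartesianProduct (allFin (order G)) (allFin (order G)))

  _EndpointOf_ : Vertex G → Pair → Set
  w EndpointOf e = w ≡ proj₁ e ⊎ w ≡ proj₂ e

  endpointOf? : ∀ w e → Dec (w EndpointOf e)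
  endpointOf? w e = (w ≟ proj₁ e) ⊎-dec (w ≟ proj₂ e)

  ShareEndpoint : Rel Pair 0ℓ
  ShareEndpoint e f = ∃ λ w → w EndpointOf e × w EndpointOf f

  JoinedByEdge : Rel Pair 0ℓ
  JoinedByEdge e f = ∃₂ λ u v → u EndpointOf e × v EndpointOf f × u ~ v

  shareEndpoint? : Decidable ShareEndpoint
  shareEndpoint? e f = any? λ w → endpointOf? w e ×-dec endpointOf? w f

  joinedByEdge? : Decidable JoinedByEdge
  joinedByEdge? e f = any? λ u → any? λ v →
    endpointOf? u e ×-dec (endpointOf? v f ×-dec (u ~? v))

  -- Only applied to lists of edges.
  IsStrongClique : List Pair → Set
  IsStrongClique S =
    All (λ e → All (λ f → e ≢ f → ShareEndpoint e f ⊎ JoinedByEdge e f) S) S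

  isStrongClique? : U.Decidable IsStrongClique
  isStrongClique? S = all? (λ e → all? (λ f →
    ¬? (e ≟ₚ f) →-dec (shareEndpoint? e f ⊎-dec joinedByEdge? e f)) S) S

  -- `edges` has no repetitions, so its sublists enumerate the sets of edges.
  strongCliques : List (List Pair)
  strongCliques = filter isStrongClique? (sublists edges)

  -- The default 0 is the size of the empty strong clique, which always exists.
  strongCliqueNumber : ℕ
  strongCliqueNumber = max 0 (map length strongCliques)

{-# OPTIONS --safe #-}

-- Fix an edge xy of a strong clique S.  Without C₃ and C₅ there are no closed
-- walks of length 5, so the vertices with a 2-walk to x and those with a 2-walk
-- to y form two disjoint independent sets, and every edge of S joins one to the
-- other.  Writing the edges of S as (a , b) accordingly, any two of them satisfy
-- a ~ b′ or a′ ~ b.  Hence the edges of a matching of size k + 1 in S form a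
-- semicomplete digraph, which has a Hamiltonian path
-- (a₁ , b₁) → … → (aₖ₊₁ , bₖ₊₁) with aᵢ ~ bᵢ₊₁.  If a₁ ~ bₖ₊₁ then
-- a₁ b₂ a₂ … aₖ bₖ₊₁ is a C₂ₖ; otherwise aₖ₊₁ ~ b₁ and b₁ a₁ … bₖ₊₁ aₖ₊₁
-- is a C₂ₖ₊₂.  So S has no matching of size k + 1, and by König's theorem it
-- is covered by k vertices, whence |S| ≤ kΔ.

module Submission where

open import Defs
open import Data.Empty using (⊥; ⊥-elim)
open import Data.Fin using (zero; suc; toℕ)
open import Data.Fin.Properties using (_≟_; any?)
import Data.Fin.Properties as Fin
open import Data.List using (List; _∷_; []; _++_; map; filter; length; lookup; allFin; cartesianProduct)
open import Data.List.Extrema.Nat using (max≤v⁺; xs≤max)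
open import Data.List.Membership.Propositional using (_∈_; _∉_; find)
open import Data.List.Membership.Propositional.Properties using (∈-∃++; ∈-filter⁺; ∈-filter⁻; ∈-++⁺ˡ; ∈-++⁺ʳ; ∈-allFin; ∈-lookup; ∈-map⁺)
open import Data.List.Properties using (length-++; length-map; length-take)
open import Data.List.Relation.Binary.Permutation.Propositional using (_↭_; ↭-refl; ↭-sym; ↭-trans; ↭⇒↭ₛ; prep; swap)
open import Data.List.Relation.Binary.Permutation.Propositional.Properties using (All-resp-↭; ∈-resp-↭; ↭-length; shift)
import Data.List.Relation.Binary.Permutation.Setoid.Properties as Permutation
open import Data.List.Relation.Unary.All as All using (All; []; _∷_)
import Data.List.Relation.Unary.All.Properties as All
open import Data.List.Relation.Unary.AllPairs as AllPairs using (AllPairs; []; _∷_)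
import Data.List.Relation.Unary.AllPairs.Properties as AllPairs
open import Data.List.Relation.Unary.Any as Any using (here; there)
open import Data.List.Relation.Unary.Linked using (Linked; []; [-]; _∷_)
open import Data.List.Relation.Unary.Unique.Propositional using (Unique)
import Data.List.Relation.Unary.Unique.Propositional.Properties as Unique
open import Data.Nat using (ℕ; suc; _+_; _*_; _∸_; _≤_; _⊔_; z≤n; s≤s; _≤?_)
open import Data.Nat.Properties hiding (_≟_; _≤?_)
open import Data.Nat.Tactic.RingSolver using (solve-∀)
open import Data.Product using (∃; ∃₂; _×_; _,_; proj₁; proj₂)
open import Data.Sum as Sum using (_⊎_; inj₁; inj₂; [_,_]′)
open import Function using (_∘_; id)
open import Level using (0ℓ)
open import Relation.Binary using (Rel; DecidableEquality)
open import Relation.Binary.PropositionalEquality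
open import Relation.Nullary using (¬_; Dec; yes; no; ¬?)
open import Relation.Nullary.Decidable using (_×-dec_; _⊎-dec_)
open import Relation.Unary using (Pred; Decidable)

-- Lists

module _ {A : Set} where

  length-filter-∁ : {P : Pred A 0ℓ} (P? : Decidable P) → ∀ xs →
    length (filter P? xs) + length (filter (¬? ∘ P?) xs) ≡ length xs
  length-filter-∁ P? []       = refl
  length-filter-∁ P? (x ∷ xs) with P? x
  ... | yes _ = cong suc (length-filter-∁ P? xs)
  ... | no  _ = trans (+-suc _ _) (cong suc (length-filter-∁ P? xs))

  AllPairs-resp-↭ : {R : Rel A 0ℓ} → (∀ {x y} → R x y → R y x) →
    ∀ {xs ys} → xs ↭ ys → AllPairs R xs → AllPairs R ys
  AllPairs-resp-↭ {R} R-sym xs↭ys =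
    Permutation.AllPairs-resp-↭ (setoid A) R-sym (resp₂ R) (↭⇒↭ₛ xs↭ys)

  lookup-injective : ∀ {xs : List A} → Unique xs → ∀ {i j} → lookup xs i ≡ lookup xs j → i ≡ j
  lookup-injective (_ ∷ _) {zero}  {zero}  _  = refl
  lookup-injective (p ∷ _) {zero}  {suc j} eq = ⊥-elim (All.lookup p (∈-lookup j) eq)
  lookup-injective (p ∷ _) {suc i} {zero}  eq = ⊥-elim (All.lookup p (∈-lookup i) (sym eq))
  lookup-injective (_ ∷ u) {suc i} {suc j} eq = cong suc (lookup-injective u eq)

  sublists-All : {P : Pred A 0ℓ} → ∀ {xs} → All P xs → All (All P) (sublists xs)
  sublists-All []       = [] ∷ []
  sublists-All (p ∷ ps) =
    All.++⁺ (All.map⁺ (All.map (p ∷_) (sublists-All ps))) (sublists-All ps)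

  sublists-AllPairs : {R : Rel A 0ℓ} → ∀ {xs} → AllPairs R xs → All (AllPairs R) (sublists xs)
  sublists-AllPairs []       = [] ∷ []
  sublists-AllPairs (p ∷ ps) = All.++⁺
    (All.map⁺ (All.zipWith (λ (q , qs) → q ∷ qs) (sublists-All p , sublists-AllPairs ps)))
    (sublists-AllPairs ps)

-- Pigeonhole: each step deletes one occurrence of `f x` from `ys`, and the later images survive
-- because they differ from `f x`.
length-injection : {A B : Set} (f : A → B) → ∀ {xs ys} →
  AllPairs (λ x y → f x ≢ f y) xs → All (λ x → f x ∈ ys) xs → length xs ≤ length ys
length-injection f [] [] = z≤n
length-injection f {x ∷ xs} {ys} (p ∷ ps) (q ∷ qs) with ∈-∃++ q
... | as , bs , refl = begin
  suc (length xs)         ≤⟨ s≤s (length-injection f ps (All.zipWith drop (p , qs))) ⟩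
  suc (length (as ++ bs)) ≡⟨ ↭-length (shift (f x) as bs) ⟨
  length (as ++ f x ∷ bs) ∎
  where
  open ≤-Reasoning
  drop : ∀ {y} → f x ≢ f y × f y ∈ as ++ f x ∷ bs → f y ∈ as ++ bs
  drop (fx≢fy , fy∈) with ∈-resp-↭ (shift (f x) as bs) fy∈
  ... | here eq  = ⊥-elim (fx≢fy (sym eq))
  ... | there m = m

AllPairs-map-All : {A : Set} {P : Pred A 0ℓ} {R R′ : Rel A 0ℓ} →
  (∀ {x y} → P x → P y → R x y → R′ x y) →
  ∀ {xs} → All P xs → AllPairs R xs → AllPairs R′ xs
AllPairs-map-All h []       []       = []
AllPairs-map-All h (p ∷ ps) (r ∷ rs) =
  All.zipWith (λ (q , s) → h p q s) (ps , r) ∷ AllPairs-map-All h ps rs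

-- Bipartite graphs

module Bipartite {E V : Set} (_≟ᵥ_ : DecidableEquality V) where

  open import Data.List.Membership.DecPropositional _≟ᵥ_ using (_∈?_)

  -- Members of `Y` are dropped from `X` before the two are joined, so that |X ∪ Y| + |X ∩ Y| = |X|
  -- + |Y| holds exactly, even for lists with repetitions.
  inter union : List V → List V → List V
  inter X Y = filter (_∈? Y) X
  union X Y = Y ++ filter (¬? ∘ (_∈? Y)) X

  length-union-inter : ∀ X Y → length (union X Y) + length (inter X Y) ≡ length X + length Y
  length-union-inter X Y = begin
    length (Y ++ X∖Y) + length X∩Y       ≡⟨ cong (_+ length X∩Y) (length-++ Y) ⟩
    length Y + length X∖Y + length X∩Y   ≡⟨ rearrange (length Y) _ _ ⟩
    length X∩Y + length X∖Y + length Y   ≡⟨ cong (_+ length Y) (length-filter-∁ (_∈? Y) X) ⟩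
    length X + length Y                  ∎
    where
    open ≡-Reasoning
    X∩Y = inter X Y
    X∖Y = filter (¬? ∘ (_∈? Y)) X
    rearrange : ∀ a b c → a + b + c ≡ c + b + a
    rearrange = solve-∀

  ∈-unionˡ : ∀ {v} X Y → v ∈ X → v ∈ union X Y
  ∈-unionˡ {v} X Y v∈X with v ∈? Y
  ... | yes v∈Y = ∈-++⁺ˡ v∈Y
  ... | no  v∉Y = ∈-++⁺ʳ Y (∈-filter⁺ (¬? ∘ (_∈? Y)) v∈X v∉Y)

  ∈-unionʳ : ∀ {v} X Y → v ∈ Y → v ∈ union X Y
  ∈-unionʳ X Y = ∈-++⁺ˡ

  ∈-inter : ∀ {v} X Y → v ∈ X → v ∈ Y → v ∈ inter X Y
  ∈-inter X Y = ∈-filter⁺ (_∈? Y)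

  -- A vertex cover is split by side. The projections are parameters so that the two sides can
  -- exchange roles.
  Covers : (p q : E → V) → List V → List V → List E → Set
  Covers p q X Y = All λ e → p e ∈ X ⊎ q e ∈ Y

  HasCover : (p q : E → V) → ℕ → List E → Set
  HasCover p q t S = ∃₂ λ X Y → Covers p q X Y S × length X + length Y ≤ t

  -- The covers X ∪ X′ ∪ {p e}, Y ∩ Y′ and X ∩ X′, Y ∪ Y′ have total size at
  -- most 2t + 1, so one of them has size at most t.
  uncross : ∀ p q {t e f R} → p e ≡ p f →
    HasCover p q t (f ∷ R) → HasCover p q t (e ∷ R) → HasCover p q t (e ∷ f ∷ R)
  uncross p q {t} {e} {f} {R} pe≡pf (X , Y , cf ∷ c , s) (X′ , Y′ , ce ∷ c′ , s′)
    with p e ∈? X | p e ∈? X′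
  -- If one of the covers contains the shared `p`-end, it covers both edges. Otherwise `f` is
  -- covered by `q f ∈ Y` and `e` by `q e ∈ Y′`.
  ... | yes m | _ = X , Y , inj₁ m ∷ cf ∷ c , s
  ... | no _ | yes m = X′ , Y′ , ce ∷ inj₁ (subst (_∈ X′) pe≡pf m) ∷ c′ , s′
  ... | no pe∉X | no pe∉X′ with suc (length (union X X′)) + length (inter Y Y′) ≤? t
  ...   | yes small = p e ∷ union X X′ , inter Y Y′ ,
            inj₁ (here refl) ∷ inj₁ (here (sym pe≡pf)) ∷ All.zipWith both (c , c′) , small
          where
          both : ∀ {g} → (p g ∈ X ⊎ q g ∈ Y) × (p g ∈ X′ ⊎ q g ∈ Y′) →
            p g ∈ p e ∷ union X X′ ⊎ q g ∈ inter Y Y′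
          both (inj₁ m , _)      = inj₁ (there (∈-unionˡ X X′ m))
          both (_ , inj₁ m)      = inj₁ (there (∈-unionʳ X X′ m))
          both (inj₂ m , inj₂ n) = inj₂ (∈-inter Y Y′ m n)
  ...   | no large = inter X X′ , union Y Y′ ,
            inj₂ (∈-unionʳ Y Y′ qe∈Y′) ∷ inj₂ (∈-unionˡ Y Y′ qf∈Y) ∷ All.zipWith both (c , c′) ,
            +-cancelˡ-≤ (suc t) _ _ (begin
              suc t + (length (inter X X′) + length (union Y Y′))
                ≤⟨ +-monoˡ-≤ _ (≰⇒> large) ⟩
              suc (length (union X X′)) + length (inter Y Y′) + (length (inter X X′) + length (union Y Y′))
                ≡⟨ rearrange (length (union X X′)) _ _ _ ⟩
              suc ((length (union X X′) + length (inter X X′)) + (length (union Y Y′) + length (inter Y Y′)))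
                ≡⟨ cong suc (cong₂ _+_ (length-union-inter X X′) (length-union-inter Y Y′)) ⟩
              suc ((length X + length X′) + (length Y + length Y′))
                ≡⟨ cong suc (interchange (length X) _ _ _) ⟩
              suc ((length X + length Y) + (length X′ + length Y′))
                ≤⟨ s≤s (+-mono-≤ s s′) ⟩
              suc t + t ∎)
          where
          open ≤-Reasoning
          rearrange : ∀ a b c d → suc a + b + (c + d) ≡ suc ((a + c) + (d + b))
          rearrange = solve-∀
          interchange : ∀ a b c d → (a + b) + (c + d) ≡ (a + c) + (b + d)
          interchange = solve-∀
          qf∈Y : q f ∈ Y
          qf∈Y = [ (λ m → ⊥-elim (pe∉X (subst (_∈ X) (sym pe≡pf) m))) , id ]′ cf
          qe∈Y′ : q e ∈ Y′
          qe∈Y′ = [ (λ m → ⊥-elim (pe∉X′ m)) , id ]′ ce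
          both : ∀ {g} → (p g ∈ X ⊎ q g ∈ Y) × (p g ∈ X′ ⊎ q g ∈ Y′) →
            p g ∈ inter X X′ ⊎ q g ∈ union Y Y′
          both (inj₂ m , _)      = inj₂ (∈-unionˡ Y Y′ m)
          both (_ , inj₂ m)      = inj₂ (∈-unionʳ Y Y′ m)
          both (inj₁ m , inj₁ n) = inj₁ (∈-inter X X′ m n)

  HasCover-swap : ∀ {p q t S} → HasCover p q t S → HasCover q p t S
  HasCover-swap (X , Y , c , s) = Y , X , All.map Sum.swap c , ≤-trans (≤-reflexive (+-comm (length Y) _)) s

  HasCover-resp-↭ : ∀ {p q t S T} → S ↭ T → HasCover p q t S → HasCover p q t T
  HasCover-resp-↭ S↭T (X , Y , c , s) = X , Y , All-resp-↭ S↭T c , s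

  -- König's theorem

  module _ (l r : E → V) where

    Disjoint : Rel E 0ℓ
    Disjoint e f = l e ≢ l f × r e ≢ r f

    Disjoint-sym : ∀ {e f} → Disjoint e f → Disjoint f e
    Disjoint-sym (l≢ , r≢) = l≢ ∘ sym , r≢ ∘ sym

    HasMatching : ℕ → List E → Set
    HasMatching n S = ∃ λ M → All (_∈ S) M × AllPairs Disjoint M × n ≤ length M

    meet? : ∀ e f → Dec (l e ≡ l f ⊎ r e ≡ r f)
    meet? e f = (l e ≟ᵥ l f) ⊎-dec (r e ≟ᵥ r f)

    -- The case split behind `könig`: either the whole list is a matching, or two meeting edges are
    -- brought to the front for uncrossing.
    meeting : ∀ S → AllPairs Disjoint S ⊎
      (∃ λ e → ∃₂ λ f R → S ↭ e ∷ f ∷ R × (l e ≡ l f ⊎ r e ≡ r f))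
    meeting [] = inj₁ []
    meeting (e ∷ S) with Any.any? (meet? e) S | meeting S
    ... | yes m | _ with find m
    ...   | f , f∈S , e-f with ∈-∃++ f∈S
    ...     | as , bs , refl = inj₂ (e , f , as ++ bs , prep e (shift f as bs) , e-f)
    meeting (e ∷ S) | no ¬m | inj₁ ps =
      inj₁ (All.map (λ n → n ∘ inj₁ , n ∘ inj₂) (All.¬Any⇒All¬ S ¬m) ∷ ps)
    meeting (e ∷ S) | no _ | inj₂ (f , g , R , S↭ , f-g) =
      inj₂ (f , g , e ∷ R , ↭-trans (prep e S↭) (↭-sym (shift e (f ∷ g ∷ []) R)) , f-g)

    -- Induction on the number of edges. When `e` and `f` meet, delete each of them in turn: a large
    -- matching in what remains is one in `S`, and two small covers are merged by `uncross`.
    könig : ∀ t S → HasMatching (suc t) S ⊎ HasCover l r t S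
    könig t S = go (length S) S ≤-refl
      where
      widen : ∀ {T S} → (∀ {e} → e ∈ T → e ∈ S) → HasMatching (suc t) T → HasMatching (suc t) S
      widen T⊆S (M , M⊆T , rest) = M , All.map T⊆S M⊆T , rest

      go : ∀ n S → length S ≤ n → HasMatching (suc t) S ⊎ HasCover l r t S
      go n S |S|≤n with meeting S
      go n S |S|≤n | inj₁ ps with length S ≤? t
      ... | no  |S|≰t = inj₁ (S , All.tabulate id , ps , ≰⇒> |S|≰t)
      -- A list of at most `t` edges is covered by its left ends.
      ... | yes |S|≤t = inj₂ (map l S , [] , All.tabulate (inj₁ ∘ ∈-map⁺ l) ,
        subst (_≤ t) (trans (sym (length-map l S)) (sym (+-identityʳ _))) |S|≤t)
      go n S |S|≤n | inj₂ (e , f , R , S↭ , e-f) with subst (_≤ n) (↭-length S↭) |S|≤n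
      go (suc n) S _ | inj₂ (e , f , R , S↭ , e-f) | s≤s bound with go n (f ∷ R) bound | go n (e ∷ R) bound
      ... | inj₁ m | _ = inj₁ (widen (∈-resp-↭ (↭-sym S↭) ∘ there) m)
      ... | inj₂ _ | inj₁ m = inj₁ (widen (∈-resp-↭ (↭-sym S↭) ∘ skip) m)
        where
        skip : ∀ {g} → g ∈ e ∷ R → g ∈ e ∷ f ∷ R
        skip (here eq) = here eq
        skip (there x) = there (there x)
      ... | inj₂ c | inj₂ c′ = inj₂ (HasCover-resp-↭ (↭-sym S↭) (glue e-f))
        where
        glue : l e ≡ l f ⊎ r e ≡ r f → HasCover l r t (e ∷ f ∷ R)
        glue (inj₁ le≡lf) = uncross l r le≡lf c c′
        glue (inj₂ re≡rf) = HasCover-swap (uncross r l re≡rf (HasCover-swap c) (HasCover-swap c′))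

  -- Counting edges through a vertex cover

  Simple : (p q : E → V) → List E → Set
  Simple p q = AllPairs λ e f → p e ≡ p f → q e ≢ q f

  module _ {nbrs : V → List V} {Δ : ℕ} (nbrs≤Δ : ∀ v → length (nbrs v) ≤ Δ) where

    -- Induction on `X`. Edges whose `p`-end is `x` have distinct `q`-ends among the neighbours of
    -- `x`, so there are at most `Δ` of them; the remaining edges are covered by the tail.
    length-covered : ∀ p q X S → Simple p q S → All (λ e → q e ∈ nbrs (p e)) S →
      All (λ e → p e ∈ X) S → length S ≤ length X * Δ
    length-covered p q []      []      _  _  _        = z≤n
    length-covered p q []      (_ ∷ _) _  _  (() ∷ _)
    length-covered p q (x ∷ X) S simple adj covered = begin
      length S                                      ≡⟨ length-filter-∁ at? S ⟨
      length (filter at? S) + length (filter off? S) ≤⟨ +-mono-≤ star rest ⟩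
      Δ + length X * Δ                              ∎
      where
      open ≤-Reasoning
      at? : Decidable (λ e → p e ≡ x)
      at? e = p e ≟ᵥ x
      off? : Decidable (λ e → p e ≢ x)
      off? = ¬? ∘ at?
      all-at : All (λ e → p e ≡ x) (filter at? S)
      all-at = All.all-filter at? S
      star : length (filter at? S) ≤ Δ
      star = ≤-trans
        (length-injection q {ys = nbrs x}
          (AllPairs-map-All (λ pe pf s → s (trans pe (sym pf))) all-at (AllPairs.filter⁺ at? simple))
          (All.zipWith (λ { (refl , m) → m }) (all-at , All.filter⁺ at? adj)))
        (nbrs≤Δ x)
      rest : length (filter off? S) ≤ length X * Δ
      rest = length-covered p q X (filter off? S) (AllPairs.filter⁺ off? simple) (All.filter⁺ off? adj)
        (All.zipWith (λ { (pe≢x , here eq) → ⊥-elim (pe≢x eq) ; (_ , there m) → m })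
          (All.all-filter off? S , All.filter⁺ off? covered))

    -- Edges with left end in `X` are counted from the left. All others have their right end in `Y`
    -- and are counted from the right.
    length-HasCover : ∀ l r {t S} → Simple l r S →
      All (λ e → r e ∈ nbrs (l e) × l e ∈ nbrs (r e)) S →
      HasCover l r t S → length S ≤ t * Δ
    length-HasCover l r {t} {S} simple adj (X , Y , c , s) = begin
      length S                                       ≡⟨ length-filter-∁ in? S ⟨
      length (filter in? S) + length (filter out? S)
        ≤⟨ +-mono-≤
             (length-covered l r X (filter in? S) (AllPairs.filter⁺ in? simple)
               (All.map proj₁ (All.filter⁺ in? adj)) (All.all-filter in? S))
             (length-covered r l Y (filter out? S)
               (AllPairs.map (λ s re≡rf le≡lf → s le≡lf re≡rf) (AllPairs.filter⁺ out? simple))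
               (All.map proj₂ (All.filter⁺ out? adj))
               (All.zipWith (λ { (n , inj₁ m) → ⊥-elim (n m) ; (_ , inj₂ m) → m })
                 (All.all-filter out? S , All.filter⁺ out? c))) ⟩
      length X * Δ + length Y * Δ                    ≡⟨ *-distribʳ-+ Δ (length X) _ ⟨
      (length X + length Y) * Δ                      ≤⟨ *-monoˡ-≤ Δ s ⟩
      t * Δ                                          ∎
      where
      open ≤-Reasoning
      in? : Decidable (λ e → l e ∈ X)
      in? e = l e ∈? X
      out? : Decidable (λ e → l e ∉ X)
      out? = ¬? ∘ in?

-- Hamiltonian paths in semicomplete digraphs

module _ {E : Set} {_⇒_ : Rel E 0ℓ} where

  -- The invariant is `h ⇒ x`: the vertex `x` moves down the path past each `y` with `y ⇒ x`, and
  -- stops before a `y` with `x ⇒ y` or at the end.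
  insertAfter : ∀ {x h ys} → All (λ y → x ⇒ y ⊎ y ⇒ x) ys → h ⇒ x → Linked _⇒_ (h ∷ ys) →
    ∃ λ zs → zs ↭ x ∷ ys × Linked _⇒_ (h ∷ zs)
  insertAfter {x} {ys = []} [] h⇒x [-] = x ∷ [] , ↭-refl , h⇒x ∷ [-]
  insertAfter {x} {ys = y ∷ ys} (inj₁ x⇒y ∷ ts) h⇒x (_ ∷ path) =
    x ∷ y ∷ ys , ↭-refl , h⇒x ∷ x⇒y ∷ path
  insertAfter {x} {ys = y ∷ ys} (inj₂ y⇒x ∷ ts) h⇒x (h⇒y ∷ path)
    with insertAfter ts y⇒x path
  ... | zs , zs↭ , path′ = y ∷ zs , ↭-trans (prep y zs↭) (swap y x ↭-refl) , h⇒y ∷ path′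

  -- Rédei's argument for tournaments: vertices are inserted one at a time, at the front if there is
  -- an arc to the first vertex of the path, and otherwise further down.
  hamiltonianPath : ∀ {xs} → AllPairs (λ x y → x ⇒ y ⊎ y ⇒ x) xs →
    ∃ λ zs → zs ↭ xs × Linked _⇒_ zs
  hamiltonianPath [] = [] , ↭-refl , []
  hamiltonianPath {x ∷ xs} (t ∷ ts) with hamiltonianPath ts
  ... | zs , zs↭ , path with All-resp-↭ (↭-sym zs↭) t
  hamiltonianPath {x ∷ xs} (t ∷ ts) | [] , zs↭ , path | [] = x ∷ [] , prep x zs↭ , [-]
  hamiltonianPath {x ∷ xs} (t ∷ ts) | z ∷ zs , zs↭ , path | inj₁ x⇒z ∷ _ =
    x ∷ z ∷ zs , prep x zs↭ , x⇒z ∷ path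
  hamiltonianPath {x ∷ xs} (t ∷ ts) | z ∷ zs , zs↭ , path | inj₂ z⇒x ∷ us
    with insertAfter us z⇒x path
  ... | ws , ws↭ , path′ =
    z ∷ ws , ↭-trans (prep z ws↭) (↭-trans (swap z x ↭-refl) (prep x zs↭)) , path′

module _ {E : Set} where

  lastOf : E → List E → E
  lastOf e []       = e
  lastOf e (f ∷ fs) = lastOf f fs

  lastOf-∈ : ∀ e fs → lastOf e fs ∈ e ∷ fs
  lastOf-∈ e []       = here refl
  lastOf-∈ e (f ∷ fs) = there (lastOf-∈ f fs)

-- Closed walks

module _ (G : Graph) where
  open Graph G using (_~_; _~?_; ~-sym; ~-irrefl; Vertex)

  -- The list holds the inner vertices only, so a closed walk `Walk v vs v` runs through `v ∷ vs`
  -- without listing `v` again at the end.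
  Walk : Vertex → List Vertex → Vertex → Set
  Walk u []       w = u ~ w
  Walk u (v ∷ vs) w = u ~ v × Walk v vs w

  Walk-step : ∀ {u vs w} → Walk u vs w → ∀ i j → toℕ j ≡ suc (toℕ i) →
    lookup (u ∷ vs) i ~ lookup (u ∷ vs) j
  Walk-step {vs = v ∷ vs} (u~v , _)  zero    (suc zero) _  = u~v
  Walk-step {vs = v ∷ vs} (_ , walk) (suc i) (suc j)    eq = Walk-step walk i j (suc-injective eq)

  Walk-last : ∀ {u vs w} → Walk u vs w → ∀ i → toℕ i ≡ length vs → lookup (u ∷ vs) i ~ w
  Walk-last {vs = []}     u~w        zero    _  = u~w
  Walk-last {vs = v ∷ vs} (_ , walk) (suc i) eq = Walk-last walk i (suc-injective eq)

  cycle : ∀ {v vs m} → Walk v vs v → Unique (v ∷ vs) → length (v ∷ vs) ≡ m → C m ⊑ G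
  cycle {v} {vs} walk unique refl =
    lookup (v ∷ vs) , lookup-injective unique , λ (_ , n) → [ step , ~-sym ∘ step ]′ n
    where
    step : ∀ {i j} → Next _ i j → lookup (v ∷ vs) i ~ lookup (v ∷ vs) j
    step {i} {j} (inj₁ eq) = Walk-step walk i j eq
    step {i} {zero} (inj₂ (eq , _)) = Walk-last walk i (suc-injective eq)

  ~⇒≢ : ∀ {u v} → u ~ v → u ≢ v
  ~⇒≢ u~u refl = ~-irrefl u~u

  noClosed3Walk : ¬ (C 3 ⊑ G) → ∀ {a b c} → a ~ b → b ~ c → c ~ a → ⊥
  noClosed3Walk noC₃ ab bc ca = noC₃ (cycle (ab , bc , ca)
    ((~⇒≢ ab ∷ ≢-sym (~⇒≢ ca) ∷ []) ∷ (~⇒≢ bc ∷ []) ∷ [] ∷ []) refl)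

  -- If two non-consecutive vertices of the walk coincide, they cut off a closed walk of length 3.
  -- Hence all five are distinct and form a `C 5`.
  noClosed5Walk : ¬ (C 3 ⊑ G) → ¬ (C 5 ⊑ G) →
    ∀ {a b c d e} → a ~ b → b ~ c → c ~ d → d ~ e → e ~ a → ⊥
  noClosed5Walk noC₃ noC₅ ab bc cd de ea = noC₅ (cycle (ab , bc , cd , de , ea)
    ( (~⇒≢ ab ∷ (λ { refl → tri cd de ea }) ∷ (λ { refl → tri ab bc cd }) ∷ ≢-sym (~⇒≢ ea) ∷ [])
    ∷ (~⇒≢ bc ∷ (λ { refl → tri de ea ab }) ∷ (λ { refl → tri bc cd de }) ∷ [])
    ∷ (~⇒≢ cd ∷ (λ { refl → tri ea ab bc }) ∷ [])
    ∷ (~⇒≢ de ∷ [])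
    ∷ [] ∷ []) refl)
    where
    tri : ∀ {a b c} → a ~ b → b ~ c → c ~ a → ⊥
    tri = noClosed3Walk noC₃

  degree≤maxDegree : ∀ v → degree G v ≤ maxDegree G
  degree≤maxDegree v = All.lookup (xs≤max 0 (map (degree G) (allFin _))) (∈-map⁺ (degree G) (∈-allFin v))

  -- Cycles from matchings in a bipartition

  module _ {A B : Pred Vertex 0ℓ} (A∩B=∅ : ∀ {v} → A v → B v → ⊥)
           (l r : Pair G → Vertex) where

    open Bipartite {Pair G} {Vertex} _≟_

    private
      Good : Pred (Pair G) 0ℓ
      Good e = A (l e) × B (r e) × l e ~ r e

      infix 4 _⇒_
      _⇒_ : Rel (Pair G) 0ℓ
      e ⇒ f = l e ~ r f

    l≢r : ∀ {e f} → Good e → Good f → l e ≢ r f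
    l≢r (a , _) (_ , b , _) eq = A∩B=∅ a (subst B (sym eq) b)

    -- For e₁, ..., eₙ the vertices r e₁, l e₁, r e₂, l e₂, ..., r eₙ, l eₙ of the longer cycle.
    fullWalk : List (Pair G) → List Vertex
    fullWalk []       = []
    fullWalk (e ∷ es) = r e ∷ l e ∷ fullWalk es

    -- The same sequence without its first and last vertex: l e₁, r e₂, l e₂, ..., r eₙ.
    innerWalk : Pair G → List (Pair G) → List Vertex
    innerWalk e []       = []
    innerWalk e (f ∷ fs) = l e ∷ r f ∷ innerWalk f fs

    length-fullWalk : ∀ es → length (fullWalk es) ≡ 2 * length es
    length-fullWalk []       = refl
    length-fullWalk (e ∷ es) = trans (cong (2 +_) (length-fullWalk es)) (sym (*-suc 2 (length es)))

    length-innerWalk : ∀ e fs → length (innerWalk e fs) ≡ 2 * length fs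
    length-innerWalk e []       = refl
    length-innerWalk e (f ∷ fs) = trans (cong (2 +_) (length-innerWalk f fs)) (sym (*-suc 2 (length fs)))

    fullWalk-All : ∀ {P : Pred Vertex 0ℓ} {es} → All (λ e → P (r e) × P (l e)) es → All P (fullWalk es)
    fullWalk-All []               = []
    fullWalk-All ((p , q) ∷ ps) = p ∷ q ∷ fullWalk-All ps

    innerWalk-All : ∀ {P : Pred Vertex 0ℓ} {e fs} → P (l e) → All (λ f → P (r f) × P (l f)) fs →
      All P (innerWalk e fs)
    innerWalk-All _ []               = []
    innerWalk-All o ((p , q) ∷ ps) = o ∷ p ∷ innerWalk-All q ps

    fullWalk-Unique : ∀ {es} → All Good es → AllPairs (Disjoint l r) es → Unique (fullWalk es)
    fullWalk-Unique [] [] = []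
    fullWalk-Unique (g ∷ gs) (d ∷ ds) =
      (≢-sym (l≢r g g) ∷
        fullWalk-All (All.zipWith (λ (h , (_ , r≢)) → r≢ , ≢-sym (l≢r h g)) (gs , d))) ∷
      fullWalk-All (All.zipWith (λ (h , (l≢ , _)) → l≢r g h , l≢) (gs , d)) ∷
      fullWalk-Unique gs ds

    innerWalk-Unique : ∀ {e fs} → All Good (e ∷ fs) → AllPairs (Disjoint l r) (e ∷ fs) →
      Unique (innerWalk e fs)
    innerWalk-Unique {fs = []} _ _ = []
    innerWalk-Unique {fs = f ∷ fs} (g ∷ h ∷ gs) (((l≢ , _) ∷ d) ∷ d′ ∷ ds) =
      (l≢r g h ∷
        innerWalk-All l≢ (All.zipWith (λ (i , (l≢ , _)) → l≢r g i , l≢) (gs , d))) ∷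
      innerWalk-All (≢-sym (l≢r h h)) (All.zipWith (λ (i , (_ , r≢)) → r≢ , ≢-sym (l≢r i h)) (gs , d′)) ∷
      innerWalk-Unique (h ∷ gs) (d′ ∷ ds)

    fullWalk-Walk : ∀ {w e fs} → All Good (e ∷ fs) → Linked _⇒_ (e ∷ fs) →
      l (lastOf e fs) ~ w → Walk (r e) (l e ∷ fullWalk fs) w
    fullWalk-Walk ((_ , _ , e) ∷ []) [-] end = ~-sym e , end
    fullWalk-Walk ((_ , _ , e) ∷ gs) (s ∷ path) end = ~-sym e , s , fullWalk-Walk gs path end

    innerWalk-Walk : ∀ {w e f fs} → All Good (f ∷ fs) → Linked _⇒_ (e ∷ f ∷ fs) →
      r (lastOf f fs) ~ w → Walk (l e) (r f ∷ innerWalk f fs) w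
    innerWalk-Walk {fs = []} _ (s ∷ [-]) end = s , end
    innerWalk-Walk {fs = _ ∷ _} ((_ , _ , e) ∷ gs) (s ∷ path) end =
      s , ~-sym e , innerWalk-Walk gs path end

    matching⇒cycle : ∀ {k M} → 1 ≤ k → length M ≡ suc k → All Good M → AllPairs (Disjoint l r) M →
      AllPairs (λ e f → e ⇒ f ⊎ f ⇒ e) M → C (2 * k) ⊑ G ⊎ C (2 * k + 2) ⊑ G
    matching⇒cycle {k} 1≤k |M| good disj total with hamiltonianPath total
    ... | es , es↭M , path = close es path
      (trans (↭-length es↭M) |M|)
      (All-resp-↭ (↭-sym es↭M) good)
      (AllPairs-resp-↭ (Disjoint-sym l r) (↭-sym es↭M) disj)
      (AllPairs-resp-↭ Sum.swap (↭-sym es↭M) total)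
      where
      close : ∀ es → Linked _⇒_ es → length es ≡ suc k → All Good es → AllPairs (Disjoint l r) es →
        AllPairs (λ e f → e ⇒ f ⊎ f ⇒ e) es → C (2 * k) ⊑ G ⊎ C (2 * k + 2) ⊑ G
      -- Since `1 ≤ k`, the path has at least two edges of the matching, so its first and last are
      -- different entries.
      close (e ∷ []) _ refl _ _ _ = ⊥-elim (1+n≰n 1≤k)
      close (e ∷ f ∷ fs) path@(_ ∷ _) refl good@(_ ∷ good′) disj (t ∷ _) with All.lookup t (lastOf-∈ f fs)
      -- An arc from first to last closes the inner walk on 2k vertices; the reverse arc closes the
      -- full walk on 2(k + 1) vertices.
      ... | inj₁ e⇒g = inj₁ (cycle (innerWalk-Walk good′ path (~-sym e⇒g))
              (innerWalk-Unique good disj) (length-innerWalk e (f ∷ fs)))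
      ... | inj₂ g⇒e = inj₂ (cycle (fullWalk-Walk good path g⇒e) (fullWalk-Unique good disj)
              (trans (length-fullWalk (e ∷ f ∷ fs)) (trans (*-suc 2 k) (+-comm 2 (2 * k)))))

  -- The bipartition around an edge xy

  module _ (noC₃ : ¬ (C 3 ⊑ G)) (noC₅ : ¬ (C 5 ⊑ G)) where

    -- Walks instead of paths, so that `x` is on its own side as soon as it has a neighbour.
    TwoWalk : Vertex → Pred Vertex 0ℓ
    TwoWalk x v = ∃ λ w → v ~ w × w ~ x

    twoWalk? : ∀ x → Decidable (TwoWalk x)
    twoWalk? x v = any? λ w → (v ~? w) ×-dec (w ~? x)

    -- An edge `u ~ v` would complete the closed 5-walk u v b x a.
    TwoWalk-independent : ∀ {x u v} → TwoWalk x u → TwoWalk x v → ¬ (u ~ v)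
    TwoWalk-independent (a , u~a , a~x) (b , v~b , b~x) u~v =
      noClosed5Walk noC₃ noC₅ u~v v~b b~x (~-sym a~x) (~-sym u~a)

    -- A common vertex would give the closed 5-walk v a x y b.
    TwoWalk-disjoint : ∀ {x y v} → x ~ y → TwoWalk x v → TwoWalk y v → ⊥
    TwoWalk-disjoint x~y (a , v~a , a~x) (b , v~b , b~y) =
      noClosed5Walk noC₃ noC₅ v~a a~x x~y (~-sym b~y) (~-sym v~b)

    module _ {x y : Vertex} (x~y : x ~ y) where

      -- Puts the end on the side of `x` first. Testing one end is enough for edges near `xy`: by
      -- `near⇒sides` and `TwoWalk-disjoint`, exactly one end is on that side.
      orient : Pair G → Pair G
      orient (u , v) with twoWalk? x u
      ... | yes _ = u , v
      ... | no  _ = v , u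

      l r : Pair G → Vertex
      l = proj₁ ∘ orient
      r = proj₂ ∘ orient

      Oriented : Pred (Pair G) 0ℓ
      Oriented e = TwoWalk x (l e) × TwoWalk y (r e) × l e ~ r e

      orient-Oriented : ∀ {u v} → u ~ v →
        (TwoWalk x u × TwoWalk y v) ⊎ (TwoWalk x v × TwoWalk y u) → Oriented (u , v)
      orient-Oriented {u} {v} u~v sides with twoWalk? x u | sides
      ... | yes _ | inj₁ (a , b) = a , b , u~v
      ... | yes a | inj₂ (_ , b) = ⊥-elim (TwoWalk-disjoint x~y a b)
      ... | no ¬a | inj₁ (a , _) = ⊥-elim (¬a a)
      ... | no _  | inj₂ (a , b) = a , b , ~-sym u~v

      endpoint : ∀ e {w} → _EndpointOf_ G w e → w ≡ l e ⊎ w ≡ r e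
      endpoint (u , v) w∈e with twoWalk? x u
      ... | yes _ = w∈e
      ... | no  _ = Sum.swap w∈e

      orient-injective : ∀ {e f} → IsEdge G e → IsEdge G f → l e ≡ l f → r e ≡ r f → e ≡ f
      orient-injective {u , v} {u′ , v′} (u<v , _) (u′<v′ , _) with twoWalk? x u | twoWalk? x u′
      ... | yes _ | yes _ = cong₂ _,_
      ... | no _  | no _  = λ p q → cong₂ _,_ q p
      -- If only one of the pairs is reversed, they would be (u , v) and (v , u), which cannot both
      -- be increasing.
      ... | yes _ | no _  = λ { refl refl → ⊥-elim (Fin.<-asym u<v u′<v′) }
      ... | no _  | yes _ = λ { refl refl → ⊥-elim (Fin.<-asym u<v u′<v′) }

      x-side : TwoWalk x x
      x-side = y , x~y , ~-sym x~y

      y-side : TwoWalk y y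
      y-side = x , ~-sym x~y , x~y

      Near : Rel (Pair G) 0ℓ
      Near e f = e ≢ f → ShareEndpoint G e f ⊎ JoinedByEdge G e f

      -- If one end is `x`, its partner reaches `y` through `x`. If one end is adjacent to `x`, that
      -- end reaches `y` through `x`, and its partner reaches `x` through that end. The cases at `y`
      -- are symmetric.
      near⇒sides : ∀ {u v} → u ~ v → Near (x , y) (u , v) →
        (TwoWalk x u × TwoWalk y v) ⊎ (TwoWalk x v × TwoWalk y u)
      near⇒sides {u} {v} u~v near with _≟ₚ_ G (x , y) (u , v)
      ... | yes refl = inj₁ (x-side , y-side)
      ... | no  ≢uv with near ≢uv
      ...   | inj₁ (w , inj₁ refl , inj₁ refl) = inj₁ (x-side , x , ~-sym u~v , x~y)
      ...   | inj₁ (w , inj₁ refl , inj₂ refl) = inj₂ (x-side , x , u~v , x~y)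
      ...   | inj₁ (w , inj₂ refl , inj₁ refl) = inj₂ ((y , ~-sym u~v , ~-sym x~y) , y-side)
      ...   | inj₁ (w , inj₂ refl , inj₂ refl) = inj₁ ((y , u~v , ~-sym x~y) , y-side)
      ...   | inj₂ (_ , _ , inj₁ refl , inj₁ refl , x~u) =
        inj₂ ((u , ~-sym u~v , ~-sym x~u) , x , ~-sym x~u , x~y)
      ...   | inj₂ (_ , _ , inj₁ refl , inj₂ refl , x~v) =
        inj₁ ((v , u~v , ~-sym x~v) , x , ~-sym x~v , x~y)
      ...   | inj₂ (_ , _ , inj₂ refl , inj₁ refl , y~u) =
        inj₁ ((y , ~-sym y~u , ~-sym x~y) , u , ~-sym u~v , ~-sym y~u)
      ...   | inj₂ (_ , _ , inj₂ refl , inj₂ refl , y~v) =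
        inj₂ ((y , ~-sym y~v , ~-sym x~y) , v , u~v , ~-sym y~v)

      -- A shared endpoint is on the same side in both edges, since the sides are disjoint, and then
      -- `e` or `f` itself is the required edge. A joining edge runs between the sides, since each
      -- side is independent.
      near⇒semicomplete : ∀ {e f} → Oriented e → Oriented f → Near e f → l e ~ r f ⊎ l f ~ r e
      near⇒semicomplete {e} {f} (ae , be , le~re) (af , bf , lf~rf) near with _≟ₚ_ G e f
      ... | yes refl = inj₁ le~re
      ... | no e≢f with near e≢f
      ...   | inj₁ (w , w∈e , w∈f) with endpoint e w∈e | endpoint f w∈f
      ...     | inj₁ p | inj₁ q = inj₁ (subst (_~ r f) (trans (sym q) p) lf~rf)
      ...     | inj₂ p | inj₂ q = inj₁ (subst (l e ~_) (trans (sym p) q) le~re)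
      ...     | inj₁ p | inj₂ q = ⊥-elim (TwoWalk-disjoint x~y ae (subst (TwoWalk y) (trans (sym q) p) bf))
      ...     | inj₂ p | inj₁ q = ⊥-elim (TwoWalk-disjoint x~y af (subst (TwoWalk y) (trans (sym p) q) be))
      near⇒semicomplete {e} {f} (ae , be , le~re) (af , bf , lf~rf) near | no _ | inj₂ (u , v , u∈e , v∈f , u~v)
        with endpoint e u∈e | endpoint f v∈f
      ...     | inj₁ refl | inj₂ refl = inj₁ u~v
      ...     | inj₂ refl | inj₁ refl = inj₂ (~-sym u~v)
      ...     | inj₁ refl | inj₁ refl = ⊥-elim (TwoWalk-independent ae af u~v)
      ...     | inj₂ refl | inj₂ refl = ⊥-elim (TwoWalk-independent be bf u~v)

    -- The bound for a single strong clique

    open Bipartite {Pair G} {Vertex} _≟_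

    strongClique-bound : ∀ k → 1 ≤ k → ¬ (C (2 * k) ⊑ G) → ¬ (C (2 * k + 2) ⊑ G) →
      ∀ S → All (IsEdge G) S → Unique S → IsStrongClique G S → length S ≤ k * maxDegree G
    strongClique-bound k 1≤k noC₂ₖ noC₂ₖ₊₂ [] _ _ _ = z≤n
    -- The first edge of `S` serves as `xy`; `near` compares it with every member of `S`, itself
    -- included.
    strongClique-bound k 1≤k noC₂ₖ noC₂ₖ₊₂ S@((x , y) ∷ _) edges@((_ , x~y) ∷ _) unique clique@(near ∷ _) =
      [ ⊥-elim ∘ noMatching , length-HasCover {nbrs = nbrs} degree≤maxDegree l′ r′ simple adjacent ]′ (könig l′ r′ k S)
      where
      l′ = l x~y
      r′ = r x~y

      oriented : All (Oriented x~y) S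
      oriented = All.zipWith (λ { ((_ , u~v) , n) → orient-Oriented x~y u~v (near⇒sides x~y u~v n) })
        (edges , near)

      simple : Simple l′ r′ S
      simple = AllPairs-map-All (λ e f e≢f l≡ r≡ → e≢f (orient-injective x~y e f l≡ r≡)) edges unique

      nbrs : Vertex → List Vertex
      nbrs v = filter (v ~?_) (allFin _)

      ~⇒∈nbrs : ∀ {u v} → u ~ v → v ∈ nbrs u
      ~⇒∈nbrs {u} = ∈-filter⁺ (u ~?_) (∈-allFin _)

      adjacent : All (λ e → r′ e ∈ nbrs (l′ e) × l′ e ∈ nbrs (r′ e)) S
      adjacent = All.map (λ (_ , _ , l~r) → ~⇒∈nbrs l~r , ~⇒∈nbrs (~-sym l~r)) oriented

      semicomplete : ∀ {e f} → e ∈ S → f ∈ S → l′ e ~ r′ f ⊎ l′ f ~ r′ e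
      semicomplete e∈S f∈S = near⇒semicomplete x~y (All.lookup oriented e∈S) (All.lookup oriented f∈S)
        (All.lookup (All.lookup clique e∈S) f∈S)

      noMatching : ¬ HasMatching l′ r′ (suc k) S
      noMatching (M , M⊆S , disj , k<|M|) = [ noC₂ₖ , noC₂ₖ₊₂ ]′
        (matching⇒cycle {A = TwoWalk x} {B = TwoWalk y} (TwoWalk-disjoint x~y) l′ r′ 1≤k
          -- The matching may be larger, so it is cut to exactly k + 1 edges to give the prescribed
          -- cycle lengths.
          (trans (length-take (suc k) M) (m≤n⇒m⊓n≡m k<|M|))
          (All.map (All.lookup oriented) M′⊆S)
          M′-disj
          (AllPairs-map-All (λ e∈S f∈S _ → semicomplete e∈S f∈S) M′⊆S M′-disj))
        where
        M′⊆S = All.take⁺ (suc k) M⊆S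
        M′-disj = AllPairs.take⁺ (suc k) disj

theorem10 : (k : ℕ) → 2 ≤ k → (G : Graph) →
    (C 3 ∷ C 5 ∷ C (2 * k) ∷ C (2 * k + 2) ∷ []) -Free G →
    strongCliqueNumber G ≤ (k * maxDegree G) ⊔ (2 * k * (k ∸ 1))
theorem10 k 2≤k G (noC₃ ∷ noC₅ ∷ noC₂ₖ ∷ noC₂ₖ₊₂ ∷ []) =
  -- Every strong clique has at most kΔ edges; `z≤n` accounts for the default value 0 of `max`.
  ≤-trans (max≤v⁺ z≤n (All.map⁺ (All.tabulate bound))) (m≤m⊔n _ _)
  where
  vertices = allFin (Graph.order G)

  edges-Unique : Unique (edges G)
  edges-Unique = Unique.filter⁺ (isEdge? G)
    (Unique.cartesianProduct⁺ (Unique.allFin⁺ _) (Unique.allFin⁺ _))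

  bound : ∀ {S} → S ∈ strongCliques G → length S ≤ k * maxDegree G
  bound {S} S∈ with ∈-filter⁻ (isStrongClique? G) {xs = sublists (edges G)} S∈
  ... | S⊆edges , clique = strongClique-bound G noC₃ noC₅ k (≤-trans (n≤1+n 1) 2≤k) noC₂ₖ noC₂ₖ₊₂ S
    (All.lookup (sublists-All (All.all-filter (isEdge? G) (cartesianProduct vertices vertices))) S⊆edges)
    (All.lookup (sublists-AllPairs edges-Unique) S⊆edges)
    clique
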